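{- Let $m\geq 2$, $n>1$ and $p\geq 1$ be integers and let $a_1,\ldots,a_m$ be positive integers with $\prod_{i=1}^m a_i\equiv 1\pmod 2$. The graph $a_1H_{n,p}\otimes a_2H_{n,p}\otimes\cdots\otimes a_mH_{n,p}$ is distance magic if and only if $n\equiv 0\pmod 2$ or $n\equiv p\equiv 1\pmod 2$.
   Context: A graph $G$ on $v$ vertices is distance magic if there is a bijection $f:V(G)\to\{1,\ldots,v\}$ and a constant $k$ such that for every vertex $x$, $\sum_{y\in N(x)}f(y)=k$, where $N(x)$ is the set of neighbours of $x$. $H_{n,p}$ denotes the complete multipartite graph with $p$ partite sets each of size $n$; $aH$ denotes the disjoint union of $a$ copies of $H$. The Kronecker (tensor) product $G\otimes H$ has vertex set $V(G)\times V(H)$, with $(g,h)\sim(g',h')$ iff $gg'\in E(G)$ and $hh'\in E(H)$. -}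

module Defs where

open import Data.Fin.Base using (Fin; toℕ)
open import Data.Fin.Properties using (*↔×) renaming (_≟_ to _≟ᶠ_)
open import Data.List.Base using (List; allFin; filter; map)
open import Data.Nat.Base using (ℕ; suc; _*_; _<_; z<s)
open import Data.Nat.ListAction using (sum)
open import Data.Product.Base using (_×_; _,_; proj₁; Σ-syntax)
open import Data.Product.Function.NonDependent.Propositional using (_×-↔_)
open import Data.Vec.Base using (Vec; []; _∷_)
open import Function.Base using (_∘_)
open import Function.Bundles using (_↔_; _⤖_; Inverse; Bijection)
open import Function.Properties.Inverse using (↔-refl; ↔-trans)
open import Relation.Binary.Definitions using (Decidable; Irreflexive; Symmetric)
open import Relation.Binary.PropositionalEquality using (_≡_; refl; sym; _≢_; ≢-sym)
open import Relation.Nullary.Decidable using (¬?; _×-dec_)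

record Graph : Set₁ where
  infix 4 _~_ _~?_
  field
    V        : Set
    order    : ℕ
    enum     : Fin order ↔ V
    _~_      : V → V → Set
    _~?_     : Decidable _~_
    ~-sym    : Symmetric _~_
    ~-irrefl : Irreflexive _≡_ _~_

  vertices : List V
  vertices = map (Inverse.to enum) (allFin order)

  neighbours : V → List V
  neighbours x = filter (x ~?_) vertices

open Graph using (V; order; neighbours)

-- Fin v stands for the label set {1,…,v}: the element i is the label 1 + toℕ i.
label : ∀ {v} → Fin v → ℕ
label i = suc (toℕ i)

DistanceMagic : Graph → Set
DistanceMagic G =
  Σ[ f ∈ V G ⤖ Fin (order G) ] Σ[ k ∈ ℕ ]
    ∀ x → sum (map (label ∘ Bijection.to f) (neighbours G x)) ≡ k

-- The complete multipartite graph with p partite sets of size n;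
-- (i , j) is the j-th vertex of the i-th partite set.
H : (n p : ℕ) → Graph
H n p = record
  { V        = Fin p × Fin n
  ; order    = p * n
  ; enum     = *↔×
  ; _~_      = λ x y → proj₁ x ≢ proj₁ y
  ; _~?_     = λ x y → ¬? (proj₁ x ≟ᶠ proj₁ y)
  ; ~-sym    = ≢-sym
  ; ~-irrefl = λ { refl i≢i → i≢i refl }
  }

infixr 8 _copiesOf_
infixr 7 _⊗_

_copiesOf_ : ℕ → Graph → Graph
a copiesOf G = record
  { V        = Fin a × G.V
  ; order    = a * G.order
  ; enum     = ↔-trans *↔× (↔-refl ×-↔ G.enum)
  ; _~_      = λ (c , x) (d , y) → c ≡ d × x G.~ y
  ; _~?_     = λ (c , x) (d , y) → (c ≟ᶠ d) ×-dec (x G.~? y)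
  ; ~-sym    = λ (c≡d , x~y) → sym c≡d , G.~-sym x~y
  ; ~-irrefl = λ { refl (_ , x~x) → G.~-irrefl refl x~x }
  }
  where module G = Graph G

_⊗_ : Graph → Graph → Graph
G ⊗ K = record
  { V        = G.V × K.V
  ; order    = G.order * K.order
  ; enum     = ↔-trans *↔× (G.enum ×-↔ K.enum)
  ; _~_      = λ (g , k) (g′ , k′) → g G.~ g′ × k K.~ k′
  ; _~?_     = λ (g , k) (g′ , k′) → (g G.~? g′) ×-dec (k K.~? k′)
  ; ~-sym    = λ (g~g′ , k~k′) → G.~-sym g~g′ , K.~-sym k~k′
  ; ~-irrefl = λ { refl (g~g , _) → G.~-irrefl refl g~g }
  }
  where
  module G = Graph G
  module K = Graph K

-- G₁ ⊗ (G₂ ⊗ (⋯ ⊗ Gₘ)). The empty product is excluded because the unit of ⊗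
-- is a vertex with a loop, which is not a simple graph.
⨂ : ∀ {m} → .(0 < m) → Vec Graph m → Graph
⨂ _ (G ∷ [])         = G
⨂ _ (G ∷ Gs@(_ ∷ _)) = G ⊗ ⨂ z<s Gs

{-# OPTIONS --safe #-}
module Submission where

-- The product is a blow-up: its vertices split into M = a₁⋯aₘ pᵐ classes of N = nᵐ vertices,
-- and adjacency depends only on the classes, through the Kronecker product of m matrices
-- I ⊗ (J − I). This matrix has constant row sums, so a labelling with equal class sums is
-- distance magic; for p > 1 it is injective, so conversely all class sums of a distance
-- magic labelling equal N(MN + 1)/2, which is not an integer when n is odd and p is even.
-- Equal class sums are realised by giving each class one label from each of the N intervals
-- of length M: consecutive intervals are paired in opposite orders, and for odd N (then M is
-- odd as well) the three remaining intervals are matched by a 3 × M magic rectangle.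

open import Defs
open import Data.Nat.ListAction using (product)
open import Data.Nat.Base using (ℕ; _≥_; _>_; _%_)
open import Data.Nat.Properties using (<⇒≤)
open import Data.Product.Base using (_×_)
open import Data.Sum.Base using (_⊎_)
open import Data.Vec.Base using (Vec; map; toList)
open import Data.Vec.Relation.Unary.All using (All)
open import Function.Bundles using (_⇔_)
open import Relation.Binary.PropositionalEquality using (_≡_)

import Algebra.Properties.Semiring.Sum
open import Data.Bool.Base using (Bool; true; false; not; _∧_; if_then_else_)
open import Data.Fin.Base using (Fin; zero; suc; toℕ; combine; remQuot; opposite; fromℕ<; _↑ˡ_; _↑ʳ_)
open import Data.Fin.Permutation using (Permutation; cast-id; reverse; ↔⇒≡)
open import Data.Fin.Properties using (*↔×; +↔⊎; remQuot-combine; combine-remQuot; toℕ-combine; toℕ-cast; toℕ-↑ˡ; toℕ-↑ʳ; toℕ<n; opposite-prop) renaming (_≟_ to _≟ᶠ_)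
open import Data.List.Base as List using (tabulate; filter)
open import Data.List.Properties using (map-tabulate)
open import Data.Nat.Base using (zero; suc; _+_; _*_; _∸_; _^_; _/_; _<_; z≤n; s≤s; z<s; NonZero; >-nonZero)
open import Data.Nat.DivMod using (m≡m%n+[m/n]*n; %-distribˡ-*; %-distribˡ-+; m*n%n≡0; m%n<n)
import Data.Nat.ListAction as ℕList
open import Data.Nat.Properties using (+-*-semiring; +-identityʳ; +-suc; +-assoc; *-comm; *-assoc; *-identityʳ; *-zeroʳ; *-cancelˡ-≡; +-cancelˡ-≡; +-cancelʳ-≡; m+[n∸m]≡n; m≤m*n; m^n>0; <-≤-trans; ≤-refl; suc-injective; *-mono-≤)
open import Data.Nat.Solver using (module +-*-Solver)
open import Data.Product.Base using (Σ-syntax; _,_; proj₁; proj₂; ∃)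
open import Data.Product.Function.NonDependent.Propositional using (_×-↔_)
open import Data.Sum.Algebra using (⊎-comm)
open import Data.Sum.Base using (inj₁; inj₂)
open import Data.Sum.Function.Propositional using (_⊎-↔_)
open import Data.Vec.Base using ([]; _∷_)
open import Data.Vec.Relation.Unary.All using ([]; _∷_)
open import Function.Base using (_∘_; const)
open import Function.Bundles using (_↔_; mk↔ₛ′; mk⇔; Inverse; Bijection)
open import Function.Properties.Bijection using (⤖⇒↔)
open import Function.Properties.Inverse using (↔-refl; ↔-sym; ↔-trans; ↔⇒⤖)
open import Level using (0ℓ)
open import Relation.Binary.PropositionalEquality using (refl; sym; trans; cong; cong₂; subst; module ≡-Reasoning)
open import Relation.Nullary.Decidable using (does)
open import Relation.Nullary.Negation using (contradiction)
open import Relation.Unary using (Pred; Decidable)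

open Algebra.Properties.Semiring.Sum +-*-semiring using (sum; sum-cong-≗; sum-permute; sum-replicate-zero; ∑-distrib-+; *-distribˡ-sum)
open Inverse using (to; from; strictlyInverseˡ; strictlyInverseʳ)
open ≡-Reasoning

-- Sums over enumerated types

sum-const : ∀ n x → sum {n} (const x) ≡ n * x
sum-const zero    x = refl
sum-const (suc n) x = cong (x +_) (sum-const n x)

sum-+ : ∀ m {n} (f : Fin (m + n) → ℕ) → sum f ≡ sum (f ∘ (_↑ˡ n)) + sum (f ∘ (m ↑ʳ_))
sum-+ zero    f = refl
sum-+ (suc m) f rewrite sum-+ m (f ∘ suc) = sym (+-assoc (f zero) _ _)

sum-* : ∀ m {n} (f : Fin (m * n) → ℕ) → sum f ≡ sum {m} (λ i → sum {n} (λ j → f (combine i j)))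
sum-* zero        f = refl
sum-* (suc m) {n} f = trans (sum-+ n f) (cong (sum {n} (f ∘ (_↑ˡ m * n)) +_) (sum-* m (f ∘ (n ↑ʳ_))))

module _ {k} {X : Set} (e : Fin k ↔ X) where

  total : (X → ℕ) → ℕ
  total w = sum (w ∘ to e)

  total-cong : ∀ {v w : X → ℕ} → (∀ x → v x ≡ w x) → total v ≡ total w
  total-cong v≗w = sum-cong-≗ (v≗w ∘ to e)

  total-const : ∀ s → total (const s) ≡ k * s
  total-const = sum-const k

  total-* : ∀ s (w : X → ℕ) → total (λ x → s * w x) ≡ s * total w
  total-* s w = sym (*-distribˡ-sum s (w ∘ to e))

  total-if : ∀ b (w : X → ℕ) → total (λ x → if b then w x else 0) ≡ (if b then total w else 0)
  total-if true  w = refl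
  total-if false w = sum-replicate-zero k

-- `e`, `φ` and the inverse of `e′` compose to a bijection of index sets, under which a sum is
-- invariant.
total-reindex : ∀ {k l} {X Y : Set} (e : Fin k ↔ X) (e′ : Fin l ↔ Y) (φ : X ↔ Y) (w : Y → ℕ) →
                total e′ w ≡ total e (w ∘ to φ)
total-reindex e e′ φ w = trans
  (sum-permute (w ∘ to e′) (↔-trans e (↔-trans φ (↔-sym e′))))
  (sum-cong-≗ λ i → cong w (strictlyInverseˡ e′ (to φ (to e i))))

infixr 2 _×ₑ_
_×ₑ_ : ∀ {k l} {X Y : Set} → Fin k ↔ X → Fin l ↔ Y → Fin (k * l) ↔ (X × Y)
e ×ₑ e′ = ↔-trans *↔× (e ×-↔ e′)

total-× : ∀ {k l} {X Y : Set} (e : Fin k ↔ X) (e′ : Fin l ↔ Y) (w : X × Y → ℕ) →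
          total (e ×ₑ e′) w ≡ total e (λ x → total e′ (λ y → w (x , y)))
total-× {k} {l} e e′ w = trans (sum-* k _) (sum-cong-≗ λ i → sum-cong-≗ λ j →
  cong (λ (a , b) → w (to e a , to e′ b)) (remQuot-combine {k} {l} i j))

-- 0/1 matrices

Matrix : Set → Set
Matrix X = X → X → Bool

module _ {k} {X : Set} (e : Fin k ↔ X) (A : Matrix X) where

  apply : (X → ℕ) → X → ℕ
  apply f x = total e λ y → if A x y then f y else 0

  Regular : ℕ → Set
  Regular d = ∀ x → apply (const 1) x ≡ d

  -- Phrased for pairs of vectors, because over ℕ there are no differences with which to state a
  -- trivial kernel.
  Injective : Set
  Injective = ∀ f g → (∀ x → apply f x ≡ apply g x) → ∀ x → f x ≡ g x

  apply-cong : ∀ {f g : X → ℕ} → (∀ x → f x ≡ g x) → ∀ x → apply f x ≡ apply g x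
  apply-cong f≗g x = total-cong e λ y → cong (if A x y then_else 0) (f≗g y)

  apply-* : ∀ s (f : X → ℕ) x → apply (λ y → s * f y) x ≡ s * apply f x
  apply-* s f x = trans (total-cong e λ y → if-* (A x y) (f y)) (total-* e s (λ y → if A x y then f y else 0))
    where
    if-* : ∀ b z → (if b then s * z else 0) ≡ s * (if b then z else 0)
    if-* true  z = refl
    if-* false z = sym (*-zeroʳ s)

  apply-const : ∀ {d} → Regular d → ∀ s x → apply (const s) x ≡ s * d
  apply-const {d} reg s x = begin
    apply (const s) x        ≡⟨ apply-cong (λ _ → sym (*-identityʳ s)) x ⟩
    apply (const (s * 1)) x  ≡⟨ apply-* s (const 1) x ⟩
    s * apply (const 1) x    ≡⟨ cong (s *_) (reg x) ⟩
    s * d                    ∎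

  -- A vanishing degree would send the constants 0 and 1 to the same vector.
  constant-preimage : ∀ {d k} → Regular d → Injective → (f : X → ℕ) → (∀ x → apply f x ≡ k) →
                      ∀ x y → f x ≡ f y
  constant-preimage {zero} reg inj f Af≡k x y =
    contradiction (inj (const 1) (const 0) (λ z → trans (reg z) (sym (apply-const reg 0 z))) x) λ ()
  constant-preimage {d@(suc _)} {k} reg inj f Af≡k x y =
    *-cancelˡ-≡ (f x) (f y) d (trans (d*f≡k x) (sym (d*f≡k y)))
    where
    -- Regularity sends the constant `k` to `k * d`, which is also the image of `d * f`; scaling `f`
    -- replaces a division of `k` by `d`.
    d*f≡k : ∀ z → d * f z ≡ k
    d*f≡k = inj (λ z → d * f z) (const k) λ z → begin
      apply (λ z → d * f z) z  ≡⟨ apply-* d f z ⟩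
      d * apply f z            ≡⟨ cong (d *_) (Af≡k z) ⟩
      d * k                    ≡⟨ *-comm d k ⟩
      k * d                    ≡⟨ apply-const reg k z ⟨
      apply (const k) z        ∎

infixr 7 _⊠_
_⊠_ : ∀ {X Y} → Matrix X → Matrix Y → Matrix (X × Y)
(A ⊠ B) (x , y) (x′ , y′) = A x x′ ∧ B y y′

module _ {k l} {X Y : Set} (e : Fin k ↔ X) (e′ : Fin l ↔ Y) (A : Matrix X) (B : Matrix Y) where

  -- The sum over pairs is iterated, and the bit `A x x′` is constant in the inner sum, so it can be
  -- pulled out.
  apply-⊠ : ∀ f x y → apply (e ×ₑ e′) (A ⊠ B) f (x , y)
                        ≡ apply e A (λ x′ → apply e′ B (λ y′ → f (x′ , y′)) y) x
  apply-⊠ f x y = trans (total-× e e′ (λ z → if (A ⊠ B) (x , y) z then f z else 0)) (total-cong e λ x′ → trans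
    (total-cong e′ λ y′ → if-∧ (A x x′) (B y y′) (f (x′ , y′)))
    (total-if e′ (A x x′) (λ y′ → if B y y′ then f (x′ , y′) else 0)))
    where
    if-∧ : ∀ a b z → (if a ∧ b then z else 0) ≡ (if a then (if b then z else 0) else 0)
    if-∧ true  b z = refl
    if-∧ false b z = refl

  ⊠-regular : ∀ {c d} → Regular e A c → Regular e′ B d → Regular (e ×ₑ e′) (A ⊠ B) (d * c)
  ⊠-regular {c} {d} regA regB (x , y) = trans (apply-⊠ (const 1) x y)
    (trans (apply-cong e A (λ _ → regB y) x) (apply-const e A regA d x))

  -- For fixed `y′`, `injA` strips the outer matrix from the partial sums over the second
  -- coordinate; `injB` then acts at fixed `x`.
  ⊠-injective : Injective e A → Injective e′ B → Injective (e ×ₑ e′) (A ⊠ B)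
  ⊠-injective injA injB f g Af≡Ag (x , y) =
    injB (λ y′ → f (x , y′)) (λ y′ → g (x , y′)) (λ y′ →
      injA (λ x′ → apply e′ B (λ y″ → f (x′ , y″)) y′) (λ x′ → apply e′ B (λ y″ → g (x′ , y″)) y′) (λ x′ →
        trans (sym (apply-⊠ f x′ y′)) (trans (Af≡Ag (x′ , y′)) (apply-⊠ g x′ y′))) x) y

-- The identity matrix I; its complement `δᶜ` is J - I. In the blow-ups `δ` compares copies and `δᶜ`
-- partite sets.
δ : ∀ {k} → Matrix (Fin k)
δ i j = does (i ≟ᶠ j)

δᶜ : ∀ {k} → Matrix (Fin k)
δᶜ i j = not (δ i j)

apply-δ : ∀ {k} f (i : Fin k) → apply ↔-refl δ f i ≡ f i
apply-δ {suc k} f zero    = trans (cong (f zero +_) (sum-replicate-zero k)) (+-identityʳ _)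
-- The first summand is 0 and comparing successors computes to comparing predecessors, so the
-- recursive call already has the required type.
apply-δ {suc k} f (suc i) = apply-δ (f ∘ suc) i

δ-regular : ∀ {k} → Regular {k} ↔-refl δ 1
δ-regular = apply-δ (const 1)

δ-injective : ∀ {k} → Injective {k} ↔-refl δ
δ-injective f g eq i = trans (sym (apply-δ f i)) (trans (eq i) (apply-δ g i))

-- I + (J - I) = J, and every row of J sums all of `f`. Adding `f i` on the left avoids subtraction.
apply-δᶜ : ∀ {k} f (i : Fin k) → f i + apply ↔-refl δᶜ f i ≡ sum f
apply-δᶜ f i = begin
  f i + apply ↔-refl δᶜ f i                   ≡⟨ cong (_+ apply ↔-refl δᶜ f i) (apply-δ f i) ⟨
  apply ↔-refl δ f i + apply ↔-refl δᶜ f i    ≡⟨ ∑-distrib-+ (λ j → if δ i j then f j else 0) _ ⟨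
  sum (λ j → (if δ i j then f j else 0) + (if δᶜ i j then f j else 0))
                                              ≡⟨ sum-cong-≗ (λ j → if-not (δ i j) (f j)) ⟩
  sum f                                       ∎
  where
  if-not : ∀ b z → (if b then z else 0) + (if not b then z else 0) ≡ z
  if-not true  z = +-identityʳ z
  if-not false z = refl

δᶜ-regular : ∀ {k} → Regular {k} ↔-refl δᶜ (k ∸ 1)
δᶜ-regular {suc k} i = suc-injective (begin
  1 + apply ↔-refl δᶜ (const 1) i  ≡⟨ apply-δᶜ (const 1) i ⟩
  sum {suc k} (const 1)            ≡⟨ sum-const (suc k) 1 ⟩
  suc k * 1                        ≡⟨ *-identityʳ (suc k) ⟩
  suc k                            ∎)

-- Summing f i + (δᶜ f) i = sum f over all i recovers sum f from δᶜ f when k > 1.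
δᶜ-injective : ∀ {k} → 1 < k → Injective {k} ↔-refl δᶜ
δᶜ-injective {suc (suc k)} (s≤s _) f g eq i = +-cancelʳ-≡ (apply ↔-refl δᶜ f i) (f i) (g i) (begin
  f i + apply ↔-refl δᶜ f i  ≡⟨ apply-δᶜ f i ⟩
  sum f                      ≡⟨ *-cancelˡ-≡ (sum f) (sum g) (suc k) sums ⟩
  sum g                      ≡⟨ apply-δᶜ g i ⟨
  g i + apply ↔-refl δᶜ g i  ≡⟨ cong (g i +_) (eq i) ⟨
  g i + apply ↔-refl δᶜ f i  ∎)
  where
  sum-apply : ∀ h → sum (apply ↔-refl δᶜ h) ≡ suc k * sum h
  sum-apply h = +-cancelˡ-≡ (sum h) _ _ (begin
    sum h + sum (apply ↔-refl δᶜ h)          ≡⟨ ∑-distrib-+ h (apply ↔-refl δᶜ h) ⟨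
    sum (λ j → h j + apply ↔-refl δᶜ h j)    ≡⟨ sum-cong-≗ (apply-δᶜ h) ⟩
    sum {suc (suc k)} (const (sum h))        ≡⟨ sum-const (suc (suc k)) (sum h) ⟩
    suc (suc k) * sum h                      ∎)

  sums : suc k * sum f ≡ suc k * sum g
  sums = begin
    suc k * sum f               ≡⟨ sum-apply f ⟨
    sum (apply ↔-refl δᶜ f)     ≡⟨ sum-cong-≗ eq ⟩
    sum (apply ↔-refl δᶜ g)     ≡⟨ sum-apply g ⟩
    suc k * sum g               ∎

-- Blow-ups

-- G arises from the 0/1 matrix adj on Class by replacing every class with
-- an independent set indexed by Slot.
record Blowup (G : Graph) : Set₁ where
  open Graph G
  field
    {count size} : ℕ
    {Class Slot} : Set
    classes      : Fin count ↔ Class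
    slots        : Fin size ↔ Slot
    split        : (Class × Slot) ↔ V
    adj          : Matrix Class
    adj-correct  : ∀ c i d j → does (to split (c , i) ~? to split (d , j)) ≡ adj c d
    {degree}     : ℕ
    regular      : Regular classes adj degree

  classSum : (V → ℕ) → Class → ℕ
  classSum w c = total slots λ i → w (to split (c , i))

  -- Two enumerations of `V` compose to a bijection between finite index sets, which forces equal
  -- lengths.
  order≡ : order ≡ count * size
  order≡ = ↔⇒≡ (↔-trans enum (↔-sym (↔-trans (classes ×ₑ slots) split)))

  total-classSum : ∀ w → total enum w ≡ total classes (classSum w)
  total-classSum w = trans (total-reindex (classes ×ₑ slots) enum split w) (total-× classes slots (w ∘ to split))

-- Dropping an entry affects the sum exactly as weighting it by 0 does; this turns a sum over
-- neighbours into a row of a 0/1 matrix.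
sum-filter : ∀ {k} {X : Set} {P : Pred X 0ℓ} (P? : Decidable P) (w : X → ℕ) (g : Fin k → X) →
             ℕList.sum (List.map w (filter P? (tabulate g))) ≡ sum (λ i → if does (P? (g i)) then w (g i) else 0)
sum-filter {zero}  P? w g = refl
sum-filter {suc k} P? w g with does (P? (g zero))
... | true  = cong (w (g zero) +_) (sum-filter P? w (g ∘ suc))
... | false = sum-filter P? w (g ∘ suc)

module _ {G : Graph} (B : Blowup G) where
  open Graph G
  open Blowup B

  -- Once the vertices are grouped by class, the adjacency bit is independent of the slot, so a
  -- class enters with its whole sum or not at all.
  neighbour-sum : ∀ w c i → ℕList.sum (List.map w (neighbours (to split (c , i))))
                              ≡ apply classes adj (classSum w) c
  neighbour-sum w c i = begin
    ℕList.sum (List.map w (neighbours x))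
      ≡⟨ cong (λ ys → ℕList.sum (List.map w (filter (x ~?_) ys))) (map-tabulate (λ j → j) (to enum)) ⟩
    ℕList.sum (List.map w (filter (x ~?_) (tabulate (to enum))))
      ≡⟨ sum-filter (x ~?_) w (to enum) ⟩
    total enum (λ y → if does (x ~? y) then w y else 0)
      ≡⟨ total-classSum (λ y → if does (x ~? y) then w y else 0) ⟩
    total classes (λ d → total slots λ j → if does (x ~? to split (d , j)) then w (to split (d , j)) else 0)
      ≡⟨ total-cong classes (λ d → total-cong slots λ j →
           cong (λ b → if b then w (to split (d , j)) else 0) (adj-correct c i d j)) ⟩
    total classes (λ d → total slots λ j → if adj c d then w (to split (d , j)) else 0)
      ≡⟨ total-cong classes (λ d → total-if slots (adj c d) (λ j → w (to split (d , j)))) ⟩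
    apply classes adj (classSum w) c ∎
    where
    x = to split (c , i)

  neighbour-sum-constant : ∀ w s → (∀ c → classSum w c ≡ s) →
                           ∀ x → ℕList.sum (List.map w (neighbours x)) ≡ s * degree
  neighbour-sum-constant w s eq x = begin
    ℕList.sum (List.map w (neighbours x))
      ≡⟨ cong (λ y → ℕList.sum (List.map w (neighbours y))) (strictlyInverseˡ split x) ⟨
    ℕList.sum (List.map w (neighbours (to split (from split x))))
      ≡⟨ neighbour-sum w _ _ ⟩
    apply classes adj (classSum w) _
      ≡⟨ apply-cong classes adj eq _ ⟩
    apply classes adj (const s) _
      ≡⟨ apply-const classes adj regular s _ ⟩
    s * degree ∎

blowup-H : ∀ n p → Blowup (H n p)
blowup-H n p = record
  { classes     = ↔-refl
  ; slots       = ↔-refl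
  ; split       = ↔-refl
  ; adj         = δᶜ
  ; adj-correct = λ _ _ _ _ → refl
  ; regular     = δᶜ-regular
  }

-- The copy index becomes a new class coordinate, on which adjacency demands equality; copies
-- multiply the classes without enlarging them.
blowup-copies : ∀ a {G} → Blowup G → Blowup (a copiesOf G)
blowup-copies a {G} B = record
  { classes     = ↔-refl {A = Fin a} ×ₑ classes
  ; slots       = slots
  ; split       = mk↔ₛ′ (λ ((c , x) , i) → c , to split (x , i))
                        (λ (c , v) → (c , proj₁ (from split v)) , proj₂ (from split v))
                        (λ (c , v) → cong (c ,_) (strictlyInverseˡ split v))
                        (λ ((c , x) , i) → cong (λ (y , j) → (c , y) , j) (strictlyInverseʳ split (x , i)))
  ; adj         = δ ⊠ adj
  ; adj-correct = λ (c , x) i (d , y) j → cong (δ c d ∧_) (adj-correct x i y j)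
  ; regular     = ⊠-regular ↔-refl classes δ adj δ-regular regular
  }
  where open Blowup B

blowup-⊗ : ∀ {G K} → Blowup G → Blowup K → Blowup (G ⊗ K)
blowup-⊗ B D = record
  { classes     = B.classes ×ₑ D.classes
  ; slots       = B.slots ×ₑ D.slots
  ; split       = ↔-trans interchange (B.split ×-↔ D.split)
  ; adj         = B.adj ⊠ D.adj
  ; adj-correct = λ (c , c′) (i , i′) (d , d′) (j , j′) →
                    cong₂ _∧_ (B.adj-correct c i d j) (D.adj-correct c′ i′ d′ j′)
  ; regular     = ⊠-regular B.classes D.classes B.adj D.adj B.regular D.regular
  }
  where
  module B = Blowup B
  module D = Blowup D
  interchange : ∀ {X Y Z W : Set} → ((X × Y) × (Z × W)) ↔ ((X × Z) × (Y × W))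
  interchange = mk↔ₛ′ (λ ((x , y) , (z , w)) → (x , z) , (y , w)) (λ ((x , z) , (y , w)) → (x , y) , (z , w))
                      (λ _ → refl) (λ _ → refl)

module _ (n p : ℕ) where

  blowup-⨂ : ∀ {m} .(0<m : 0 < m) (a : Vec ℕ m) → Blowup (⨂ 0<m (map (_copiesOf H n p) a))
  blowup-⨂ () []
  blowup-⨂ _  (a ∷ [])         = blowup-copies a (blowup-H n p)
  blowup-⨂ _  (a ∷ as@(_ ∷ _)) = blowup-⊗ (blowup-copies a (blowup-H n p)) (blowup-⨂ z<s as)

  size-⨂ : ∀ {m} .(0<m : 0 < m) (a : Vec ℕ m) → Blowup.size (blowup-⨂ 0<m a) ≡ n ^ m
  size-⨂ () []
  size-⨂ _  (a ∷ [])         = sym (*-identityʳ n)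
  size-⨂ _  (a ∷ as@(_ ∷ _)) = cong (n *_) (size-⨂ z<s as)

  count-⨂ : ∀ {m} .(0<m : 0 < m) (a : Vec ℕ m) →
            Blowup.count (blowup-⨂ 0<m a) ≡ product (toList a) * p ^ m
  count-⨂ () []
  count-⨂ _  (a ∷ []) = cong₂ _*_ (sym (*-identityʳ a)) (sym (*-identityʳ p))
  count-⨂ {suc m} _ (a ∷ as@(_ ∷ _)) = trans (cong (a * p *_) (count-⨂ z<s as))
    (solve 4 (λ a p P q → a :* p :* (P :* q) := a :* P :* (p :* q)) refl a p (product (toList as)) (p ^ m))
    where open +-*-Solver

  -- For p = 1 the matrix J - I is zero; for p > 1 each factor I ⊗ (J - I) is injective, and `⊠`
  -- preserves this.
  injective-⨂ : ∀ {m} .(0<m : 0 < m) (a : Vec ℕ m) → 1 < p →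
                let open Blowup (blowup-⨂ 0<m a) in Injective classes adj
  injective-⨂ () []
  injective-⨂ _  (a ∷ []) 1<p = ⊠-injective ↔-refl ↔-refl δ δᶜ δ-injective (δᶜ-injective 1<p)
  injective-⨂ _  (a ∷ as@(_ ∷ _)) 1<p =
    ⊠-injective (↔-refl ×ₑ ↔-refl) (Blowup.classes (blowup-⨂ z<s as)) (δ ⊠ δᶜ) (Blowup.adj (blowup-⨂ z<s as))
      (⊠-injective ↔-refl ↔-refl δ δᶜ δ-injective (δᶜ-injective 1<p)) (injective-⨂ z<s as 1<p)

-- Necessity

-- Gauss's sum, doubled to avoid division. Splitting off the label 1 leaves the smaller labels, each
-- raised by one.
sum-label : ∀ v → sum {v} label * 2 ≡ v * suc v
sum-label zero    = refl
sum-label (suc v) = begin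
  suc (sum {v} (λ i → 1 + label i)) * 2         ≡⟨ cong (λ z → suc z * 2) (∑-distrib-+ {v} (const 1) label) ⟩
  suc (sum {v} (const 1) + sum {v} label) * 2   ≡⟨ cong (λ z → suc (z + sum {v} label) * 2) (sum-const v 1) ⟩
  suc (v * 1 + sum {v} label) * 2               ≡⟨ solve 2 (λ v s → (con 1 :+ (v :* con 1 :+ s)) :* con 2 := con 2 :+ v :* con 2 :+ s :* con 2) refl v (sum {v} label) ⟩
  2 + v * 2 + sum {v} label * 2                 ≡⟨ cong (2 + v * 2 +_) (sum-label v) ⟩
  2 + v * 2 + v * suc v                         ≡⟨ solve 1 (λ v → con 2 :+ v :* con 2 :+ v :* (con 1 :+ v) := (con 1 :+ v) :* (con 2 :+ v)) refl v ⟩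
  suc v * suc (suc v)                           ∎
  where open +-*-Solver

-- Injectivity makes all class sums equal to some `s`. The sum of all labels is then both
-- `count * s` and 1 + ⋯ + `order`; cancelling `count` gives the equation.
magic⇒equal-class-sums : ∀ {G} (B : Blowup G) → let open Blowup B in
  Injective classes adj → 0 < count → 0 < size → DistanceMagic G → ∃ λ s → s * 2 ≡ size * suc (count * size)
magic⇒equal-class-sums {G} B inj 0<count 0<size (f , k , magic) =
  s , *-cancelˡ-≡ _ _ count {{>-nonZero 0<count}} (begin
    count * (s * 2)                     ≡⟨ *-assoc count s 2 ⟨
    count * s * 2                       ≡⟨ cong (_* 2) (total-const classes s) ⟨
    total classes (const s) * 2         ≡⟨ cong (_* 2) (total-cong classes classSum≡s) ⟨
    total classes (classSum w) * 2      ≡⟨ cong (_* 2) (total-classSum w) ⟨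
    total enum w * 2                    ≡⟨ cong (_* 2) (total-reindex enum ↔-refl (⤖⇒↔ f) label) ⟨
    sum {order} label * 2               ≡⟨ sum-label order ⟩
    order * suc order                   ≡⟨ cong (λ v → v * suc v) order≡ ⟩
    count * size * suc (count * size)   ≡⟨ *-assoc count size _ ⟩
    count * (size * suc (count * size)) ∎)
  where
  open Graph G
  open Blowup B
  w = label ∘ Bijection.to f
  -- Nonemptiness supplies a reference class and, in every class, a vertex at which the magic
  -- condition can be read off.
  c₀ = to classes (fromℕ< 0<count)
  i₀ = to slots (fromℕ< 0<size)
  s = classSum w c₀
  classSum≡s : ∀ c → classSum w c ≡ s
  classSum≡s c = constant-preimage classes adj regular inj (classSum w)
    (λ d → trans (sym (neighbour-sum B w d i₀)) (magic (to split (d , i₀)))) c c₀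

-- Sufficiency

-- An N × M array whose rows are permutations of 0, ..., M - 1 and whose column sums agree: rows are
-- label intervals, columns are classes.
Balanced : ℕ → ℕ → Set
Balanced N M = Σ[ π ∈ (Fin N → Permutation M M) ] Σ[ s ∈ ℕ ] ∀ c → sum (λ j → toℕ (to (π j) c)) ≡ s

suc-toℕ+opposite : ∀ {n} (i : Fin n) → suc (toℕ i) + toℕ (opposite i) ≡ n
suc-toℕ+opposite i = trans (cong (suc (toℕ i) +_) (opposite-prop i)) (m+[n∸m]≡n (toℕ<n i))

-- An identity row together with its reversal adds M - 1 to every column.
balanced-2+ : ∀ {N M} → Balanced N M → Balanced (2 + N) M
balanced-2+ {N} {M} (π , s , eq) = ρ , M ∸ 1 + s , sums
  where
  ρ : Fin (2 + N) → Permutation M M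
  ρ zero          = ↔-refl
  ρ (suc zero)    = reverse
  ρ (suc (suc j)) = π j
  sums : ∀ c → sum (λ j → toℕ (to (ρ j) c)) ≡ M ∸ 1 + s
  sums c = trans (sym (+-assoc (toℕ c) _ _)) (cong₂ _+_ (cong (_∸ 1) (suc-toℕ+opposite c)) (eq c))

balanced-even : ∀ k M → Balanced (k * 2) M
balanced-even zero    M = (λ ()) , 0 , λ _ → refl
balanced-even (suc k) M = balanced-2+ (balanced-even k M)

-- The 3 × (2t + 1) magic rectangle: its columns are (2i, t − i, 2t − i) for i ≤ t and
-- (2i + 1, 2t − i, t − 1 − i) for i < t, all with sum 3t.
module _ (t : ℕ) where

  private
    -- Columns are indexed by kind: `inj₁` for the t + 1 of the first kind, `inj₂` for the t of the
    -- second.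
    X : Set
    X = Fin (suc t) ⊎ Fin t

    row₀ row₁ row₂ : X ↔ Fin (suc (t * 2))

    row₀ = mk↔ₛ′ f g f∘g g∘f
      where
      -- The value 0 is set apart; the other 2t values form t pairs (2i + 1, 2i + 2), the odd one
      -- for `inj₂ i` and the even one for `inj₁ (suc i)`.
      f : X → Fin (suc (t * 2))
      f (inj₁ zero)    = zero
      f (inj₁ (suc i)) = suc (combine i (suc zero))
      f (inj₂ i)       = suc (combine i zero)
      h : Fin t × Fin 2 → X
      h (i , zero)     = inj₂ i
      h (i , suc zero) = inj₁ (suc i)
      g : Fin (suc (t * 2)) → X
      g zero    = inj₁ zero
      g (suc k) = h (remQuot 2 k)
      f∘h : ∀ ib → f (h ib) ≡ suc (combine (proj₁ ib) (proj₂ ib))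
      f∘h (i , zero)     = refl
      f∘h (i , suc zero) = refl
      f∘g : ∀ k → f (g k) ≡ k
      f∘g zero    = refl
      f∘g (suc k) = trans (f∘h (remQuot 2 k)) (cong suc (combine-remQuot {t} 2 k))
      g∘f : ∀ x → g (f x) ≡ x
      g∘f (inj₁ zero)    = refl
      g∘f (inj₁ (suc i)) = cong h (remQuot-combine i (suc zero))
      g∘f (inj₂ i)       = cong h (remQuot-combine {k = 2} i zero)

    1+t+t≡ : suc t + t ≡ suc (t * 2)
    1+t+t≡ = solve 1 (λ t → con 1 :+ t :+ t := con 1 :+ t :* con 2) refl t
      where open +-*-Solver

    t+1+t≡ : t + suc t ≡ suc (t * 2)
    t+1+t≡ = trans (+-suc t t) 1+t+t≡

    -- The `inj₁` block runs down from t to 0, and the `inj₂` block from 2t to t + 1.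
    row₁ = ↔-trans (reverse ⊎-↔ reverse) (↔-trans (↔-sym +↔⊎) (cast-id 1+t+t≡))

    -- With the blocks exchanged, `inj₂` runs down from t - 1 to 0, and `inj₁` from 2t to t.
    row₂ = ↔-trans (⊎-comm _ _) (↔-trans (reverse ⊎-↔ reverse) (↔-trans (↔-sym +↔⊎) (cast-id t+1+t≡)))

    row₀-inj₁ : ∀ i → toℕ (to row₀ (inj₁ i)) ≡ 2 * toℕ i
    row₀-inj₁ zero    = refl
    row₀-inj₁ (suc i) = trans (cong suc (toℕ-combine i (suc zero)))
      (solve 1 (λ i → con 1 :+ (con 2 :* i :+ con 1) := con 2 :* (con 1 :+ i)) refl (toℕ i))
      where open +-*-Solver

    row₀-inj₂ : ∀ i → toℕ (to row₀ (inj₂ i)) ≡ suc (2 * toℕ i)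
    row₀-inj₂ i = cong suc (trans (toℕ-combine {n = 2} i zero) (+-identityʳ _))

    rows : Fin 3 → X ↔ Fin (suc (t * 2))
    rows zero             = row₀
    rows (suc zero)       = row₁
    rows (suc (suc zero)) = row₂

    rows-sum : ∀ x → sum (λ j → toℕ (to (rows j) x)) ≡ t + t * 2
    rows-sum (inj₁ i) = begin
      toℕ (to row₀ (inj₁ i)) + (toℕ (to row₁ (inj₁ i)) + (toℕ (to row₂ (inj₁ i)) + 0))
        ≡⟨ cong₂ _+_ (row₀-inj₁ i) (cong₂ _+_ (trans (toℕ-cast 1+t+t≡ _) (toℕ-↑ˡ (opposite i) t))
             (cong (_+ 0) (trans (toℕ-cast t+1+t≡ _) (toℕ-↑ʳ t (opposite i))))) ⟩
      2 * a + (b + (t + b + 0))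
        ≡⟨ solve 3 (λ a b t → con 2 :* a :+ (b :+ (t :+ b :+ con 0)) := t :+ (a :+ b) :* con 2) refl a b t ⟩
      t + (a + b) * 2
        -- Here i has t + 1 possible values, so a + b = t.
        ≡⟨ cong (λ z → t + z * 2) (suc-injective (suc-toℕ+opposite i)) ⟩
      t + t * 2 ∎
      where
      open +-*-Solver
      a = toℕ i
      b = toℕ (opposite i)
    rows-sum (inj₂ i) = begin
      toℕ (to row₀ (inj₂ i)) + (toℕ (to row₁ (inj₂ i)) + (toℕ (to row₂ (inj₂ i)) + 0))
        ≡⟨ cong₂ _+_ (row₀-inj₂ i) (cong₂ _+_ (trans (toℕ-cast 1+t+t≡ _) (toℕ-↑ʳ (suc t) (opposite i)))
             (cong (_+ 0) (trans (toℕ-cast t+1+t≡ _) (toℕ-↑ˡ (opposite i) (suc t))))) ⟩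
      suc (2 * a) + (suc t + b + (b + 0))
        ≡⟨ solve 3 (λ a b t → con 1 :+ con 2 :* a :+ (con 1 :+ t :+ b :+ (b :+ con 0)) := t :+ (con 1 :+ a :+ b) :* con 2) refl a b t ⟩
      t + (suc a + b) * 2
        -- Here i has only t possible values, so 1 + a + b = t.
        ≡⟨ cong (λ z → t + z * 2) (suc-toℕ+opposite i) ⟩
      t + t * 2 ∎
      where
      open +-*-Solver
      a = toℕ i
      b = toℕ (opposite i)

  -- Precomposing with the inverse of `row₀` renames the columns by `Fin`, which makes the first row
  -- the identity.
  balanced-3 : Balanced 3 (suc (t * 2))
  balanced-3 = (λ j → ↔-trans (↔-sym row₀) (rows j)) , t + t * 2 , rows-sum ∘ from row₀

  balanced-odd : ∀ k → Balanced (3 + k * 2) (suc (t * 2))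
  balanced-odd zero    = balanced-3
  balanced-odd (suc k) = balanced-2+ (balanced-odd k)

-- Slot j receives the labels in the j-th interval of length M, arranged among the classes by π j.
balanced⇒magic : ∀ {G} (B : Blowup G) → Balanced (Blowup.size B) (Blowup.count B) → DistanceMagic G
balanced⇒magic {G} B (π , s , eq) = ↔⇒⤖ f , _ , neighbour-sum-constant B (label ∘ to f) r classSum≡r
  where
  open Graph G
  open Blowup B
  ρ : (Fin count × Fin size) ↔ (Fin size × Fin count)
  ρ = mk↔ₛ′ (λ (c , j) → j , to (π j) c) (λ (j , d) → from (π j) d , j)
            (λ (j , d) → cong (j ,_) (strictlyInverseˡ (π j) d))
            (λ (c , j) → cong (_, j) (strictlyInverseʳ (π j) c))
  -- The factors are swapped because labels are numbered interval by interval: `combine j d` has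
  -- value `count * toℕ j + toℕ d`.
  size*count≡order : size * count ≡ order
  size*count≡order = trans (*-comm size count) (sym order≡)
  f : V ↔ Fin order
  f = ↔-trans (↔-sym split) (↔-trans (↔-sym classes ×-↔ ↔-sym slots)
        (↔-trans ρ (↔-trans (↔-sym *↔×) (cast-id size*count≡order))))
  -- Every class collects the first label of each interval, plus offsets whose sum is the common
  -- column sum `s`; `suc` is there because labels start at 1.
  r = sum {size} (λ j → suc (count * toℕ j)) + s
  label-f : ∀ c j → label (to f (to split (c , to slots j))) ≡ suc (count * toℕ j) + toℕ (to (π j) (from classes c))
  label-f c j = cong suc (begin
    toℕ (to f (to split (c , to slots j)))
      ≡⟨ toℕ-cast size*count≡order _ ⟩
    toℕ (from *↔× (to ρ (to (↔-sym classes ×-↔ ↔-sym slots) (from split (to split (c , to slots j))))))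
      ≡⟨ cong (λ y → toℕ (from *↔× (to ρ (to (↔-sym classes ×-↔ ↔-sym slots) y)))) (strictlyInverseʳ split _) ⟩
    toℕ (from *↔× (to ρ (from classes c , from slots (to slots j))))
      ≡⟨ cong (λ i → toℕ (from *↔× (to ρ (from classes c , i)))) (strictlyInverseʳ slots j) ⟩
    toℕ (combine j (to (π j) (from classes c)))
      ≡⟨ toℕ-combine j _ ⟩
    count * toℕ j + toℕ (to (π j) (from classes c)) ∎)
  classSum≡r : ∀ c → classSum (label ∘ to f) c ≡ r
  classSum≡r c = begin
    sum (λ j → label (to f (to split (c , to slots j))))
      ≡⟨ sum-cong-≗ (label-f c) ⟩
    sum (λ j → suc (count * toℕ j) + toℕ (to (π j) (from classes c)))
      ≡⟨ ∑-distrib-+ (λ j → suc (count * toℕ j)) (λ j → toℕ (to (π j) (from classes c))) ⟩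
    sum {size} (λ j → suc (count * toℕ j)) + sum (λ j → toℕ (to (π j) (from classes c)))
      ≡⟨ cong (sum {size} (λ j → suc (count * toℕ j)) +_) (eq (from classes c)) ⟩
    r ∎

-- Parity

odd-* : ∀ {m n} → m % 2 ≡ 1 → n % 2 ≡ 1 → (m * n) % 2 ≡ 1
odd-* {m} {n} m-odd n-odd = trans (%-distribˡ-* m n 2) (cong₂ (λ x y → (x * y) % 2) m-odd n-odd)

even-*ˡ : ∀ {m} n → m % 2 ≡ 0 → (m * n) % 2 ≡ 0
even-*ˡ {m} n m-even = trans (%-distribˡ-* m n 2) (cong (λ x → (x * (n % 2)) % 2) m-even)

even-*ʳ : ∀ m {n} → n % 2 ≡ 0 → (m * n) % 2 ≡ 0
even-*ʳ m {n} n-even = trans (cong (_% 2) (*-comm m n)) (even-*ˡ {n} m n-even)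

odd-^ : ∀ {n} m → n % 2 ≡ 1 → (n ^ m) % 2 ≡ 1
odd-^ zero    n-odd = refl
odd-^ {n} (suc m) n-odd = odd-* {n} {n ^ m} n-odd (odd-^ {n} m n-odd)

parity : ∀ n → n % 2 ≡ 0 ⊎ n % 2 ≡ 1
parity n with n % 2 | m%n<n n 2
... | 0 | _ = inj₁ refl
... | 1 | _ = inj₂ refl
... | suc (suc _) | s≤s (s≤s ())

odd-balanced : ∀ {N M} → 1 < N → N % 2 ≡ 1 → M % 2 ≡ 1 → Balanced N M
odd-balanced {N} {M} 1<N N-odd M-odd
  with N / 2 | trans (m≡m%n+[m/n]*n N 2) (cong (_+ N / 2 * 2) N-odd)
-- A zero quotient means N = 1, a single row; otherwise N is 3 + 2k, the shape built up from three
-- rows.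
... | zero  | refl = contradiction 1<N λ { (s≤s ()) }
... | suc k | refl
  with M / 2 | trans (m≡m%n+[m/n]*n M 2) (cong (_+ M / 2 * 2) M-odd)
... | t | refl = balanced-odd t k

even-balanced : ∀ {N} M → N % 2 ≡ 0 → Balanced N M
even-balanced {N} M N-even = subst (λ N → Balanced N M)
  (sym (trans (m≡m%n+[m/n]*n N 2) (cong (_+ N / 2 * 2) N-even))) (balanced-even (N / 2) M)

product≥1 : ∀ {m} {a : Vec ℕ m} → All (_≥ 1) a → product (toList a) ≥ 1
product≥1 []       = ≤-refl
product≥1 (x ∷ xs) = *-mono-≤ x (product≥1 xs)

even⇒>1 : ∀ {p} → p ≥ 1 → p % 2 ≡ 0 → p > 1
even⇒>1 {suc (suc p)} _ _ = s≤s (s≤s z≤n)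

theorem17 : (m n p : ℕ) (m≥2 : m ≥ 2) → n > 1 → p ≥ 1 →
    (a : Vec ℕ m) → All (_≥ 1) a → product (toList a) % 2 ≡ 1 →
    DistanceMagic (⨂ (<⇒≤ m≥2) (map (_copiesOf H n p) a))
    ⇔ (n % 2 ≡ 0 ⊎ (n % 2 ≡ 1 × p % 2 ≡ 1))
theorem17 m@(suc m-1) n p m≥2 n>1 p≥1 a a≥1 a-odd = mk⇔ necessary sufficient
  where
  G = ⨂ (<⇒≤ m≥2) (map (_copiesOf H n p) a)
  B = blowup-⨂ n p (<⇒≤ m≥2) a
  open Blowup B using (count; size)
  instance
    n≢0 : NonZero n
    n≢0 = >-nonZero (<⇒≤ n>1)
    p≢0 : NonZero p
    p≢0 = >-nonZero p≥1

  size≡ : size ≡ n ^ m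
  size≡ = size-⨂ n p (<⇒≤ m≥2) a

  count≡ : count ≡ product (toList a) * p ^ m
  count≡ = count-⨂ n p (<⇒≤ m≥2) a

  1<size : 1 < size
  -- `n ^ m` is n times a positive power, hence at least n.
  1<size = subst (1 <_) (sym size≡) (<-≤-trans n>1 (m≤m*n n (n ^ m-1) {{>-nonZero (m^n>0 n m-1)}}))

  0<count : 0 < count
  0<count = subst (0 <_) (sym count≡) (*-mono-≤ (product≥1 a≥1) (m^n>0 p m))

  odd-size : n % 2 ≡ 1 → size % 2 ≡ 1
  odd-size n-odd = trans (cong (_% 2) size≡) (odd-^ {n} m n-odd)

  sufficient : n % 2 ≡ 0 ⊎ (n % 2 ≡ 1 × p % 2 ≡ 1) → DistanceMagic G
  sufficient (inj₁ n-even) = balanced⇒magic B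
    (even-balanced count (trans (cong (_% 2) size≡) (even-*ˡ {n} (n ^ m-1) n-even)))
  sufficient (inj₂ (n-odd , p-odd)) = balanced⇒magic B
    (odd-balanced 1<size (odd-size n-odd)
      (trans (cong (_% 2) count≡) (odd-* {product (toList a)} {p ^ m} a-odd (odd-^ {p} m p-odd))))

  necessary : DistanceMagic G → n % 2 ≡ 0 ⊎ (n % 2 ≡ 1 × p % 2 ≡ 1)
  necessary magic with parity n | parity p
  ... | inj₁ n-even | _          = inj₁ n-even
  ... | inj₂ n-odd  | inj₂ p-odd = inj₂ (n-odd , p-odd)
  -- An even positive p exceeds 1, so the matrix is injective. Then `s * 2` equals
  -- `size * suc (count * size)`, a product of two odd numbers, since `size` is odd and `count`
  -- even.
  ... | inj₂ n-odd  | inj₁ p-even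
    with s , s*2≡ ← magic⇒equal-class-sums B (injective-⨂ n p (<⇒≤ m≥2) a (even⇒>1 p≥1 p-even))
                      0<count (<⇒≤ 1<size) magic
    = contradiction (trans (sym (m*n%n≡0 s 2)) (trans (cong (_% 2) s*2≡)
        (odd-* {size} {suc (count * size)} (odd-size n-odd) odd-suc))) λ ()
    where
    even-count : count % 2 ≡ 0
    even-count = trans (cong (_% 2) count≡) (even-*ʳ (product (toList a)) {p ^ m} (even-*ˡ {p} (p ^ m-1) p-even))
    odd-suc : suc (count * size) % 2 ≡ 1
    odd-suc = trans (%-distribˡ-+ 1 (count * size) 2)
      (cong (λ x → (1 + x) % 2) (even-*ˡ {count} size even-count))
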